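{- Let $E$ be a set and let $r:2^E\times 2^E\rightarrow \mathbb{N}\cup\{\infty\}$ be a partial function, with value $r(A|B)$ defined for the pairs $(A,B)$ with $B\subseteq A\subseteq E$. Put $\mathcal{I}_r:=\{I\subseteq E\mid r(I|I\setminus\{x\})>0\text{ for all }x\in I\}$. Suppose that: (R1) $0\leq r(A|B)\leq |A\setminus B|$ for all $B\subseteq A\subseteq E$; (R2) $r(A|A\cap B)\geq r(A\cup B|B)$ for all $A,B\subseteq E$; (R3) $r(A|C)=r(A|B)+r(B|C)$ for all $C\subseteq B\subseteq A\subseteq E$; (R4) for all $B\subseteq A\subseteq E$ and every family $(A_\gamma)_{\gamma\in\Gamma}$ of sets with $B\subseteq A_\gamma$ for all $\gamma\in\Gamma$: if $A=\bigcup_{\gamma\in\Gamma}A_\gamma$ and $r(A_\gamma|B)=0$ for all $\gamma\in\Gamma$, then $r(A|B)=0$; (R5) for all $B\subseteq A\subseteq E$ there exists $I\in\mathcal{I}_r$ with $I\subseteq A$ such that $r(A|I)=0$ and $r(B|B\cap I)=0$. Then $M=(E,\mathcal{I}_r)$ is an infinite matroid, and $r=r_M$, that is, $r(A|B)=r_M(A|B)$ for all $B\subseteq A\subseteq E$, where $r_M$ is the relative rank function of $M$.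
   Context: Sets may be finite or infinite. $|X|\in\mathbb{N}\cup\{\infty\}$ denotes the number of elements of $X$ (with $|X|=\infty$ for every infinite $X$), with the usual order and addition on $\mathbb{N}\cup\{\infty\}$ ($0\in\mathbb{N}$). An infinite matroid is a pair $M=(E,\mathcal{I})$ where $E$ is any set and $\mathcal{I}$ is a set of subsets of $E$ (the independent sets) such that, with $\mathcal{I}^{\max}$ the set of inclusionwise maximal elements of $\mathcal{I}$: (I1) $\emptyset\in\mathcal{I}$; (I2) $\mathcal{I}$ is closed under taking subsets; (I3) if $I\in\mathcal{I}\setminus\mathcal{I}^{\max}$ and $I'\in\mathcal{I}^{\max}$, then $I\cup\{x\}\in\mathcal{I}$ for some $x\in I'\setminus I$; (IM) if $I\subseteq X\subseteq E$ and $I\in\mathcal{I}$, then the set $\{I'\in\mathcal{I}\mid I\subseteq I'\subseteq X\}$ has an inclusionwise maximal element. The relative rank function of $M$ is defined for $B\subseteq A\subseteq E$ by $$r_M(A|B):=\max\{|I\setminus J| \;\mid\; J\subseteq I\subseteq A,\ I\in\mathcal{I},\ J\text{ an inclusionwise maximal independent subset of }B\}.$$ -}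

module Defs where

open import Axiom.ExcludedMiddle using (ExcludedMiddle)
open import Data.Fin.Base using (Fin)
open import Data.Maybe.Base using (zipWith)
open import Data.Nat.Base as ℕ using (ℕ)
open import Data.Product.Base using (Σ; ∃; ∃₂; _×_; _,_; proj₁; proj₂)
open import Data.Sum.Base using (inj₂)
open import Function.Bundles using (_⇔_)
open import Function.Definitions using (Injective)
open import Level using (Level; Setω; suc; _⊔_)
open import Relation.Binary.PropositionalEquality.Core using (_≡_)
import Relation.Binary.Construct.Add.Supremum.NonStrict as NonStrict
import Relation.Binary.Construct.Add.Supremum.Strict as Strict
open import Relation.Nullary.Construct.Add.Supremum using (_⁺; [_]; ⊤⁺)
open import Relation.Nullary.Decidable.Core using (yes; no)
open import Relation.Nullary.Negation.Core using (¬_)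
open import Relation.Unary
  using (Pred; _∈_; _⊆_; _≐_; _∪_; _∩_; _∖_; ⋃; ｛_｝)
open import Relation.Unary.Polymorphic using (∅)

private
  variable
    ℓ p : Level
    E : Set ℓ

-- The mathematics is classical, so excluded middle is an explicit assumption.

Classical : Setω
Classical = ∀ {a} → ExcludedMiddle a

-- The power set of E : Set ℓ is Pred E ℓ.  Two predicates are the same subset
-- when they are extensionally equal (_≐_).

Subset : Set ℓ → Set (suc ℓ)
Subset {ℓ} E = Pred E ℓ

ℕ∞ : Set
ℕ∞ = ℕ ⁺

open NonStrict ℕ._≤_ public renaming (_≤⁺_ to _≤∞_) using ()
open Strict ℕ._<_ public renaming (_<⁺_ to _<∞_) using ()

infixl 6 _+∞_

_+∞_ : ℕ∞ → ℕ∞ → ℕ∞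
_+∞_ = zipWith ℕ._+_

IsMax : Pred ℕ∞ p → ℕ∞ → Set p
IsMax S m = m ∈ S × (∀ k → k ∈ S → k ≤∞ m)

-- Elements of E are enumerated, rather than pairs of an element and a
-- membership proof: membership in a predicate may have several proofs.

HasSize : Subset E → ℕ → Set _
HasSize {E = E} X n =
  Σ (Fin n → E) λ f → Injective _≡_ _≡_ f × (∀ x → x ∈ X ⇔ ∃ λ i → f i ≡ x)

card : Classical → Subset E → ℕ∞
card em X with em {P = ∃ (HasSize X)}
... | yes (n , _) = [ n ]
... | no _        = ⊤⁺

-- Inclusionwise maximal members of a family of subsets.

Maximal : {E : Set ℓ} → Pred (Subset E) p → Pred (Subset E) (suc ℓ ⊔ p)
Maximal 𝓢 X = X ∈ 𝓢 × (∀ Y → Y ∈ 𝓢 → X ⊆ Y → X ≐ Y)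

-- There is no separate requirement that 𝓘 respects _≐_: it follows from I2.

record IsInfiniteMatroid {E : Set ℓ} (𝓘 : Pred (Subset E) ℓ) : Set (suc ℓ) where
  field
    I1 : ∅ ∈ 𝓘
    I2 : ∀ (I J : Subset E) → I ∈ 𝓘 → J ⊆ I → J ∈ 𝓘
    I3 : ∀ I I′ → I ∈ 𝓘 → ¬ (I ∈ Maximal 𝓘) → I′ ∈ Maximal 𝓘 →
         ∃ λ x → x ∈ I′ ∖ I × I ∪ ｛ x ｝ ∈ 𝓘
    IM : ∀ (I X : Subset E) → I ⊆ X → I ∈ 𝓘 →
         ∃ (Maximal (λ I′ → I′ ∈ 𝓘 × I ⊆ I′ × I′ ⊆ X))

-- RelativeRank em 𝓘 A B k says that r_M(A|B) = k, where M = (E , 𝓘).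

RelativeRank : Classical → {E : Set ℓ} → Pred (Subset E) ℓ →
               (A B : Subset E) → ℕ∞ → Set (suc ℓ)
RelativeRank em {E} 𝓘 A B = IsMax λ k →
  ∃₂ λ (I J : Subset E) → J ⊆ I × I ⊆ A × I ∈ 𝓘 ×
             J ∈ Maximal (λ J′ → J′ ∈ 𝓘 × J′ ⊆ B) ×
             card em (I ∖ J) ≡ k

-- Partial functions r(A|B), defined for B ⊆ A.  The value cannot depend on the
-- proof of B ⊆ A.  That r respects _≐_ is not required separately: under R1
-- and R3 below, r(A|A′) = 0 = r(B′|B) and hence r(A|B) = r(A′|B′) whenever
-- A ≐ A′ and B ≐ B′.

RankFunction : Set ℓ → Set (suc ℓ)
RankFunction E = (A B : Subset E) → .(B ⊆ A) → ℕ∞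

Independent : {E : Set ℓ} → RankFunction E → Pred (Subset E) ℓ
Independent r I = ∀ x → x ∈ I → [ 0 ] <∞ r I (I ∖ ｛ x ｝) proj₁

record RankAxioms (em : Classical) {E : Set ℓ} (r : RankFunction E) : Set (suc ℓ) where
  field
    R1 : ∀ A B (B⊆A : B ⊆ A) →
         [ 0 ] ≤∞ r A B B⊆A × r A B B⊆A ≤∞ card em (A ∖ B)
    R2 : ∀ A B → r (A ∪ B) B inj₂ ≤∞ r A (A ∩ B) proj₁
    R3 : ∀ A B C (C⊆B : C ⊆ B) (B⊆A : B ⊆ A) →
         r A C (λ x∈C → B⊆A (C⊆B x∈C)) ≡ r A B B⊆A +∞ r B C C⊆B
    R4 : ∀ A B (B⊆A : B ⊆ A) (Γ : Set ℓ) (Aγ : Γ → Subset E)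
         (B⊆Aγ : ∀ γ → B ⊆ Aγ γ) →
         A ≐ ⋃ Γ Aγ →
         (∀ γ → r (Aγ γ) B (B⊆Aγ γ) ≡ [ 0 ]) →
         r A B B⊆A ≡ [ 0 ]
    R5 : ∀ A B → B ⊆ A →
         ∃ λ I → I ∈ Independent r × Σ (I ⊆ A) λ I⊆A →
         r A I I⊆A ≡ [ 0 ] × r B (B ∩ I) proj₁ ≡ [ 0 ]

{-# OPTIONS --safe #-}

-- A set is spanned by B exactly when each of its points is (R4), and an
-- independent I stays independent when a point outside its span is added (R3
-- and r(I ∪ x|I) ≤ 1).  Hence I is a maximal independent subset of X if and only
-- if r(X|I) = 0.  In IM, the set I′ that R5 provides for I ⊆ X spans X and contains I,
-- because I ∩ I′ spans I and I is independent: no choice principle is needed.  Adding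
-- the points of I ∖ J one at a time gives r(I|J) = |I ∖ J| for J ⊆ I independent,
-- and r(A|B) = r(A|J) = r(A|I) + r(I|J) whenever J ⊆ I and J spans B.

module Submission where

open import Defs
open import Data.Empty using (⊥-elim)
open import Data.Fin.Base using (Fin; zero; suc)
open import Data.Fin.Properties using (suc-injective)
open import Data.Nat.Base using (ℕ; zero; suc; z≤n; s≤s; _≤_; _<_)
import Data.Nat.Properties as ℕ
open import Data.Product.Base using (∃; _×_; _,_; proj₁; proj₂)
open import Data.Sum.Base using (inj₁; inj₂; [_,_]′)
open import Data.Vec.Functional using (_∷_)
open import Function.Base using (id; _∘_)
open import Function.Bundles using (mk⇔; module Equivalence)
open import Function.Definitions using (Injective)
open import Level using (Level)
import Relation.Binary.Construct.Add.Supremum.NonStrict as NonStrict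
import Relation.Binary.Construct.Add.Supremum.Strict as Strict
open import Relation.Binary.PropositionalEquality
  using (_≡_; _≢_; refl; sym; trans; cong; cong₂; subst; subst₂)
open import Relation.Nullary using (¬_; yes; no; contradiction)
open import Relation.Nullary.Construct.Add.Supremum using ([_]; ⊤⁺)
open import Relation.Nullary.Decidable using (decidable-stable)
open import Relation.Unary
  using (_∈_; _∉_; _⊆_; _∪_; _∩_; _∖_; ｛_｝)
open import Relation.Unary.Polymorphic using (U)

open NonStrict _≤_ using ([_]; _≤⊤⁺)
open Strict _<_ using ([_]; [_]<⊤⁺)

-- The order and addition of `ℕ∞`.

≤∞-refl : ∀ {a} → a ≤∞ a
≤∞-refl = NonStrict.≤⁺-reflexive-≡ _≤_ ℕ.≤-reflexive refl

≤∞-trans : ∀ {a b c} → a ≤∞ b → b ≤∞ c → a ≤∞ c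
≤∞-trans = NonStrict.≤⁺-trans _≤_ ℕ.≤-trans

≤∞-antisym : ∀ {a b} → a ≤∞ b → b ≤∞ a → a ≡ b
≤∞-antisym = NonStrict.≤⁺-antisym-≡ _≤_ ℕ.≤-antisym

a≤a+b : ∀ a b → a ≤∞ a +∞ b
a≤a+b [ m ] [ n ] = [ ℕ.m≤m+n m n ]
a≤a+b [ m ] ⊤⁺    = [ m ] ≤⊤⁺
a≤a+b ⊤⁺    b     = ⊤⁺ ≤⊤⁺

b≤a+b : ∀ a b → b ≤∞ a +∞ b
b≤a+b [ m ] [ n ] = [ ℕ.m≤n+m n m ]
b≤a+b [ m ] ⊤⁺    = ⊤⁺ ≤⊤⁺
b≤a+b ⊤⁺    b     = b ≤⊤⁺

+∞-mono-≤ : ∀ {a b c d} → a ≤∞ b → c ≤∞ d → a +∞ c ≤∞ b +∞ d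
+∞-mono-≤ [ p ]    [ q ]    = [ ℕ.+-mono-≤ p q ]
+∞-mono-≤ [ p ]    (_ ≤⊤⁺) = _ ≤⊤⁺
+∞-mono-≤ (_ ≤⊤⁺) q        = _ ≤⊤⁺

+∞-identityˡ : ∀ a → [ 0 ] +∞ a ≡ a
+∞-identityˡ [ n ] = refl
+∞-identityˡ ⊤⁺    = refl

+∞-identityʳ : ∀ a → a +∞ [ 0 ] ≡ a
+∞-identityʳ [ n ] = cong [_] (ℕ.+-identityʳ n)
+∞-identityʳ ⊤⁺    = refl

a≤0⇒a≡0 : ∀ {a} → a ≤∞ [ 0 ] → a ≡ [ 0 ]
a≤0⇒a≡0 [ z≤n ] = refl

0<a⇒1≤a : ∀ {a} → [ 0 ] <∞ a → [ 1 ] ≤∞ a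
0<a⇒1≤a [ p ]     = [ p ]
0<a⇒1≤a [ _ ]<⊤⁺ = _ ≤⊤⁺

0<-≤-trans : ∀ {a b} → [ 0 ] <∞ a → a ≤∞ b → [ 0 ] <∞ b
0<-≤-trans = Strict.<⁺-transˡ _<_ ℕ.<-≤-trans

0<a⇒a≢0 : ∀ {a} → [ 0 ] <∞ a → a ≢ [ 0 ]
0<a⇒a≢0 [ () ] refl

a≢0⇒0<a : ∀ {a} → a ≢ [ 0 ] → [ 0 ] <∞ a
a≢0⇒0<a {[ zero ]}  a≢0 = contradiction refl a≢0
a≢0⇒0<a {[ suc n ]} _   = [ s≤s z≤n ]
a≢0⇒0<a {⊤⁺}        _   = [ 0 ]<⊤⁺

0≮a⇒a≡0 : ∀ {a} → ¬ ([ 0 ] <∞ a) → a ≡ [ 0 ]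
0≮a⇒a≡0 {[ zero ]}  _   = refl
0≮a⇒a≡0 {[ suc n ]} 0≮a = contradiction [ s≤s z≤n ] 0≮a
0≮a⇒a≡0 {⊤⁺}        0≮a = contradiction [ 0 ]<⊤⁺ 0≮a

-- If `c` were zero, `d` would be at least 2. The bounds are those met in `independent-∪`, where R3
-- splits the addition of two points in two orders.
summand-positive : ∀ {a b c d} → [ 1 ] ≤∞ a → [ 1 ] ≤∞ b →
                   a +∞ b ≡ c +∞ d → d ≤∞ [ 1 ] → [ 0 ] <∞ c
summand-positive {d = d} 1≤a 1≤b a+b≡c+d d≤1 = a≢0⇒0<a λ { refl →
  2≰1 (≤∞-trans (+∞-mono-≤ 1≤a 1≤b)
    (subst (_≤∞ [ 1 ]) (sym (trans a+b≡c+d (+∞-identityˡ d))) d≤1)) }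
  where
  2≰1 : ¬ ([ 2 ] ≤∞ [ 1 ])
  2≰1 [ s≤s () ]

unbounded⇒⊤≤ : ∀ {a} → (∀ n → [ n ] ≤∞ a) → ⊤⁺ ≤∞ a
unbounded⇒⊤≤ {⊤⁺}    _ = ⊤⁺ ≤⊤⁺
unbounded⇒⊤≤ {[ m ]} h with h (suc m)
... | [ p ] = contradiction p (ℕ.<-irrefl refl)

-- Cardinalities through finite injective families.

module _ (em : Classical) {ℓ : Level} {E : Set ℓ} where

  -- Such a family need not exhaust `X`, so it bounds the cardinality from below for finite and
  -- infinite `X` alike.
  FamilyIn : Subset E → ℕ → Set ℓ
  FamilyIn X n = ∃ λ (f : Fin n → E) → Injective _≡_ _≡_ f × (∀ i → f i ∈ X)

  -- An injective family that does not enumerate `X` misses a point of it, which can be put in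
  -- front.
  FamilyIn-suc : ∀ {X n} → ¬ HasSize X n → FamilyIn X n → FamilyIn X (suc n)
  FamilyIn-suc {X} {n} ¬size (f , inj , f∈X)
    with em {P = ∃ λ x → x ∈ X × ¬ ∃ λ i → f i ≡ x}
  ... | no ¬new = ⊥-elim (¬size (f , inj , enum))
    where
    enum = λ x → mk⇔
      (λ x∈X → decidable-stable em λ x∉f → ¬new (x , x∈X , x∉f))
      (λ (i , fi≡x) → subst X fi≡x (f∈X i))
  ... | yes (x , x∈X , x∉f) = x ∷ f , inj′ , in′
    where
    inj′ : Injective _≡_ _≡_ (x ∷ f)
    inj′ {zero}  {zero}  _ = refl
    inj′ {zero}  {suc j} p = contradiction (j , sym p) x∉f
    inj′ {suc i} {zero}  p = contradiction (i , p) x∉f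
    inj′ {suc i} {suc j} p = cong suc (inj p)

    in′ : ∀ i → (x ∷ f) i ∈ X
    in′ zero    = x∈X
    in′ (suc i) = f∈X i

  infinite⇒FamilyIn : ∀ {X} → ¬ ∃ (HasSize X) → ∀ n → FamilyIn X n
  infinite⇒FamilyIn _   zero    = (λ ()) , (λ {}) , λ ()
  infinite⇒FamilyIn inf (suc n) =
    FamilyIn-suc (λ size → inf (n , size)) (infinite⇒FamilyIn inf n)

  -- A finite set has an enumeration, an infinite one has families of every length. Bounds on
  -- infinite cardinalities thus reduce to finite counting.
  card-least : ∀ X {k} → (∀ n → FamilyIn X n → [ n ] ≤∞ k) → card em X ≤∞ k
  card-least X bound with em {P = ∃ (HasSize X)}
  ... | yes (n , f , inj , enum) =
        bound n (f , inj , λ i → Equivalence.from (enum (f i)) (i , refl))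
  ... | no inf = unbounded⇒⊤≤ λ n → bound n (infinite⇒FamilyIn inf n)

  card-empty : ∀ X → (∀ x → x ∉ X) → card em X ≤∞ [ 0 ]
  card-empty X empty = card-least X λ where
    zero    _             → ≤∞-refl
    (suc n) (f , _ , f∈X) → contradiction (f∈X zero) (empty _)

  card-subsingleton : ∀ X → (∀ {x y} → x ∈ X → y ∈ X → x ≡ y) → card em X ≤∞ [ 1 ]
  card-subsingleton X unique = card-least X λ where
    zero          _               → [ z≤n ]
    (suc zero)    _               → ≤∞-refl
    (suc (suc n)) (f , inj , f∈X) →
      contradiction (inj (unique (f∈X zero) (f∈X (suc zero)))) λ ()

  -- Rank inequalities and independent sets.

  module _ (r : RankFunction E) (axioms : RankAxioms em r) where
    open RankAxioms axioms

    𝓘 : Subset E → Set ℓ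
    𝓘 = Independent r

    r-subset : ∀ A B (B⊆A : B ⊆ A) → A ⊆ B → r A B B⊆A ≡ [ 0 ]
    r-subset A B B⊆A A⊆B = a≤0⇒a≡0 (≤∞-trans (proj₂ (R1 A B B⊆A))
      (card-empty _ λ x (x∈A , x∉B) → x∉B (A⊆B x∈A)))

    r-point≤1 : ∀ B x → r (B ∪ ｛ x ｝) B inj₁ ≤∞ [ 1 ]
    r-point≤1 B x = ≤∞-trans (proj₂ (R1 (B ∪ ｛ x ｝) B inj₁))
      (card-subsingleton _ λ p q → trans (sym (≡x p)) (≡x q))
      where
      ≡x : ∀ {y} → y ∈ (B ∪ ｛ x ｝) ∖ B → x ≡ y
      ≡x (inj₁ y∈B , y∉B) = contradiction y∈B y∉B
      ≡x (inj₂ x≡y , _)   = x≡y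

    r-outer≤ : ∀ {A B C} (C⊆B : C ⊆ B) (B⊆A : B ⊆ A) →
               r A B B⊆A ≤∞ r A C (B⊆A ∘ C⊆B)
    r-outer≤ C⊆B B⊆A = subst (_ ≤∞_) (sym (R3 _ _ _ C⊆B B⊆A)) (a≤a+b _ _)

    r-inner≤ : ∀ {A B C} (C⊆B : C ⊆ B) (B⊆A : B ⊆ A) →
               r B C C⊆B ≤∞ r A C (B⊆A ∘ C⊆B)
    r-inner≤ C⊆B B⊆A = subst (_ ≤∞_) (sym (R3 _ _ _ C⊆B B⊆A)) (b≤a+b _ _)

    -- This is R2 for `A` and `B′`, with R3 used twice: to shrink `A ∪ B′` to `A′`, and to shrink
    -- `A ∩ B′` to `B`.
    r-antitone : ∀ {A B A′ B′} (B⊆A : B ⊆ A) (B′⊆A′ : B′ ⊆ A′) →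
                 B ⊆ B′ → A′ ⊆ A ∪ B′ → r A′ B′ B′⊆A′ ≤∞ r A B B⊆A
    r-antitone {A} {B} {A′} {B′} B⊆A B′⊆A′ B⊆B′ A′⊆A∪B′ =
      ≤∞-trans (r-inner≤ B′⊆A′ A′⊆A∪B′)
      (≤∞-trans (R2 A B′)
      (r-outer≤ (λ x∈B → B⊆A x∈B , B⊆B′ x∈B) proj₁))

    ⊆-point : ∀ (K : Subset E) {x} → K ⊆ ｛ x ｝ ∪ (K ∖ ｛ x ｝)
    ⊆-point K {x} {y} y∈K with em {P = x ≡ y}
    ... | yes x≡y = inj₁ x≡y
    ... | no  x≢y = inj₂ (y∈K , x≢y)

    spanned : ∀ {A B} (B⊆A : B ⊆ A) →
              (∀ x → x ∈ A → r (B ∪ ｛ x ｝) B inj₁ ≡ [ 0 ]) → r A B B⊆A ≡ [ 0 ]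
    spanned {A} {B} B⊆A zeros =
      -- The index set is `A` itself. If it is empty, so is `B`, and the empty union is still `A`.
      R4 A B B⊆A (∃ A) (λ (x , _) → B ∪ ｛ x ｝) (λ _ → inj₁)
        ( (λ {x} x∈A → (x , x∈A) , inj₂ refl)
        , λ where
            (_ , inj₁ y∈B)          → B⊆A y∈B
            ((x , x∈A) , inj₂ refl) → x∈A )
        (λ (x , x∈A) → zeros x x∈A)

    -- By `r-antitone`, `x` adds at least as much rank to `J` as to the larger set `K ∖ ｛ x ｝`,
    -- where independence makes it positive.
    independent-point : ∀ {K J x} → K ∈ 𝓘 → J ⊆ K → x ∈ K → x ∉ J →
                        [ 0 ] <∞ r (J ∪ ｛ x ｝) J inj₁
    independent-point {K} {J} {x} K∈𝓘 J⊆K x∈K x∉J =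
      0<-≤-trans (K∈𝓘 x x∈K) (r-antitone inj₁ proj₁
        (λ y∈J → J⊆K y∈J , λ { refl → x∉J y∈J })
        ([ inj₁ ∘ inj₂ , inj₂ ]′ ∘ ⊆-point K))

    independent-⊆ : ∀ {I J} → I ∈ 𝓘 → J ⊆ I → J ∈ 𝓘
    independent-⊆ {I} I∈𝓘 J⊆I x x∈J =
      0<-≤-trans (I∈𝓘 x (J⊆I x∈J)) (r-antitone proj₁ proj₁
        (λ (y∈J , x≢y) → J⊆I y∈J , x≢y)
        ([ (λ { refl → inj₁ x∈J }) , inj₂ ]′ ∘ ⊆-point I))

    -- For y ∈ I, r(I ∪ x|I ∖ y) ≥ 2 by R3 through I, and r((I ∪ x) ∖ y|I ∖ y) ≤ 1.
    independent-∪ : ∀ {I x} → I ∈ 𝓘 → [ 0 ] <∞ r (I ∪ ｛ x ｝) I inj₁ →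
                    I ∪ ｛ x ｝ ∈ 𝓘
    independent-∪ {I} {x} I∈𝓘 0<r y (inj₂ refl) = 0<-≤-trans 0<r (r-outer≤ ∖⊆I inj₁)
      where
      ∖⊆I : (I ∪ ｛ x ｝) ∖ ｛ x ｝ ⊆ I
      ∖⊆I (inj₁ z∈I , _)   = z∈I
      ∖⊆I (inj₂ x≡z , x≢z) = contradiction x≡z x≢z
    independent-∪ {I} {x} I∈𝓘 0<r y (inj₁ y∈I) =
      summand-positive (0<a⇒1≤a 0<r) (0<a⇒1≤a (I∈𝓘 y y∈I))
        (trans (sym (R3 K I (I ∖ ｛ y ｝) proj₁ inj₁))
          (R3 K (K ∖ ｛ y ｝) (I ∖ ｛ y ｝) I∖y⊆K∖y proj₁))
        (≤∞-trans (r-antitone inj₁ I∖y⊆K∖y id K∖y⊆) (r-point≤1 (I ∖ ｛ y ｝) x))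
      where
      K = I ∪ ｛ x ｝

      I∖y⊆K∖y : I ∖ ｛ y ｝ ⊆ K ∖ ｛ y ｝
      I∖y⊆K∖y (z∈I , y≢z) = inj₁ z∈I , y≢z

      K∖y⊆ : K ∖ ｛ y ｝ ⊆ ((I ∖ ｛ y ｝) ∪ ｛ x ｝) ∪ (I ∖ ｛ y ｝)
      K∖y⊆ (inj₁ z∈I , y≢z) = inj₂ (z∈I , y≢z)
      K∖y⊆ (inj₂ x≡z , _)   = inj₁ (inj₂ x≡z)

    -- Maximal independent sets as spanning sets.

    spanning⇒maximal : ∀ {I X} (I⊆X : I ⊆ X) → r X I I⊆X ≡ [ 0 ] →
                       ∀ {Y} → Y ∈ 𝓘 → I ⊆ Y → Y ⊆ X → Y ⊆ I
    spanning⇒maximal I⊆X rXI≡0 Y∈𝓘 I⊆Y Y⊆X y∈Y =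
      -- A point `y` of `Y` outside `I` would have positive rank over `I`, but R3 bounds that rank
      -- by r(X|I) = 0.
      decidable-stable em λ y∉I → 0<a⇒a≢0
        (0<-≤-trans (independent-point Y∈𝓘 I⊆Y y∈Y y∉I)
          (r-inner≤ inj₁ [ I⊆X , (λ { refl → Y⊆X y∈Y }) ]′))
        rXI≡0

    -- An unspanned point could be added to `I` independently; maximality would then put it in `I`,
    -- where it adds no rank.
    maximal⇒spanning : ∀ {I X} (I⊆X : I ⊆ X) → I ∈ 𝓘 →
                       (∀ Y → Y ∈ 𝓘 → I ⊆ Y → Y ⊆ X → Y ⊆ I) → r X I I⊆X ≡ [ 0 ]
    maximal⇒spanning {I} I⊆X I∈𝓘 max = spanned I⊆X λ x x∈X → 0≮a⇒a≡0 λ 0<r →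
      let I∪x⊆I = max (I ∪ ｛ x ｝) (independent-∪ I∈𝓘 0<r) inj₁
                    [ I⊆X , (λ { refl → x∈X }) ]′
      in 0<a⇒a≢0 0<r (r-subset _ _ inj₁ I∪x⊆I)

    -- If `x` lies in `I` but not in `J`, then `I ∖ ｛ x ｝` contains `I ∩ J` and so spans `I` too,
    -- against independence.
    spanning-⊇ : ∀ {I J : Subset E} → I ∈ 𝓘 → r I (I ∩ J) proj₁ ≡ [ 0 ] → I ⊆ J
    spanning-⊇ I∈𝓘 r≡0 x∈I = decidable-stable em λ x∉J → 0<a⇒a≢0
      (0<-≤-trans (I∈𝓘 _ x∈I)
        (r-outer≤ (λ (y∈I , y∈J) → y∈I , λ { refl → x∉J y∈J }) proj₁))
      r≡0

    -- The matroid axioms.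

    exchange : ∀ I I′ → I ∈ 𝓘 → ¬ (I ∈ Maximal 𝓘) → I′ ∈ Maximal 𝓘 →
               ∃ λ x → x ∈ I′ ∖ I × I ∪ ｛ x ｝ ∈ 𝓘
    exchange I I′ I∈𝓘 ¬max (I′∈𝓘 , max′) = decidable-stable em λ ¬ex →
      -- If no point can be exchanged, `I` spans every point of `I′`: an unspanned one would lie
      -- outside `I` and extend it.
      let I∪I′-spanned = spanned {I ∪ I′} inj₁ λ where
            x (inj₁ x∈I)  → r-subset _ _ inj₁ [ id , (λ { refl → x∈I }) ]′
            x (inj₂ x∈I′) → 0≮a⇒a≡0 λ 0<r → ¬ex
              ( x
              , (x∈I′ , λ x∈I → 0<a⇒a≢0 0<r
                          (r-subset _ _ inj₁ [ id , (λ { refl → x∈I }) ]′))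
              , independent-∪ I∈𝓘 0<r )
          -- Maximality in `𝓘` is maximality inside `U`, so `I′` spans everything, and hence so does
          -- the larger `I ∪ I′`.
          E-spanned-by-I∪I′ = a≤0⇒a≡0 (subst (r U (I ∪ I′) _ ≤∞_)
            (maximal⇒spanning {X = U} _ I′∈𝓘 λ Y Y∈𝓘 I′⊆Y _ → proj₂ (max′ Y Y∈𝓘 I′⊆Y))
            (r-outer≤ inj₂ _))
          E-spanned-by-I = trans (R3 U (I ∪ I′) I inj₁ _)
            (cong₂ _+∞_ E-spanned-by-I∪I′ I∪I′-spanned)
      in ¬max (I∈𝓘 , λ Y Y∈𝓘 I⊆Y →
           (λ {_} → I⊆Y) , spanning⇒maximal {X = U} _ E-spanned-by-I Y∈𝓘 I⊆Y _)

    isInfiniteMatroid : IsInfiniteMatroid 𝓘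
    isInfiniteMatroid = record
      { I1 = λ _ ()
      ; I2 = λ _ _ → independent-⊆
      ; I3 = exchange
      ; IM = λ I X I⊆X I∈𝓘 →
          let I′ , I′∈𝓘 , I′⊆X , rXI′≡0 , rI≡0 = R5 X I I⊆X
          in I′ , (I′∈𝓘 , (λ {_} → spanning-⊇ I∈𝓘 rI≡0) , λ {_} → I′⊆X)
           , λ Y (Y∈𝓘 , _ , Y⊆X) I′⊆Y →
               (λ {_} → I′⊆Y) , spanning⇒maximal I′⊆X rXI′≡0 Y∈𝓘 I′⊆Y Y⊆X
      }

    -- The rank formula.

    FamilyIn⇒≤r : ∀ {I J} → I ∈ 𝓘 → (J⊆I : J ⊆ I) →
                  ∀ n → FamilyIn (I ∖ J) n → [ n ] ≤∞ r I J J⊆I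
    FamilyIn⇒≤r {I} {J} I∈𝓘 J⊆I zero    _             = proj₁ (R1 I J J⊆I)
    FamilyIn⇒≤r {I} {J} I∈𝓘 J⊆I (suc n) (f , inj , f∈) =
      -- The first point moves into `J` while `I` stays fixed. R3 separates its contribution, at
      -- least 1, from that of the other `n` points, and the sum appears as n + 1.
      subst₂ _≤∞_ (cong [_] (ℕ.+-comm n 1)) (sym (R3 I J₊ J inj₁ J₊⊆I))
        (+∞-mono-≤
          (FamilyIn⇒≤r I∈𝓘 J₊⊆I n
            (f ∘ suc , (λ p → suc-injective (inj p)) , f∘suc∈))
          (0<a⇒1≤a (independent-point I∈𝓘 J⊆I (proj₁ (f∈ zero)) (proj₂ (f∈ zero)))))
      where
      J₊ = J ∪ ｛ f zero ｝

      J₊⊆I : J₊ ⊆ I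
      J₊⊆I (inj₁ x∈J)  = J⊆I x∈J
      J₊⊆I (inj₂ refl) = proj₁ (f∈ zero)

      f∘suc∈ : ∀ i → f (suc i) ∈ I ∖ J₊
      f∘suc∈ i = proj₁ (f∈ (suc i)) ,
        [ proj₂ (f∈ (suc i)) , (λ p → contradiction (inj p) λ ()) ]′

    r-independent : ∀ {I J} → I ∈ 𝓘 → (J⊆I : J ⊆ I) → r I J J⊆I ≡ card em (I ∖ J)
    r-independent {I} {J} I∈𝓘 J⊆I =
      ≤∞-antisym (proj₂ (R1 I J J⊆I)) (card-least _ (FamilyIn⇒≤r I∈𝓘 J⊆I))

    r-basis : ∀ {A B J} (B⊆A : B ⊆ A) (J⊆B : J ⊆ B) → r B J J⊆B ≡ [ 0 ] →
              r A J (B⊆A ∘ J⊆B) ≡ r A B B⊆A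
    r-basis {A} {B} {J} B⊆A J⊆B rBJ≡0 =
      trans (R3 A B J J⊆B B⊆A) (trans (cong (r A B B⊆A +∞_) rBJ≡0) (+∞-identityʳ _))

    relativeRank : ∀ A B (B⊆A : B ⊆ A) → RelativeRank em 𝓘 A B (r A B B⊆A)
    relativeRank A B B⊆A .proj₁ =
      -- The maximum is attained at the set from R5: `I` spans `A`, and `B ∩ I` spans `B`.
      let I , I∈𝓘 , I⊆A , rAI≡0 , rB≡0 = R5 A B B⊆A
          B∩I⊆I = λ {x} → proj₂ {A = x ∈ B} {B = λ _ → x ∈ I}
      in I , B ∩ I , (λ {_} → B∩I⊆I) , (λ {_} → I⊆A) , I∈𝓘
       , ( (independent-⊆ I∈𝓘 B∩I⊆I , λ {_} → proj₁)
         , λ Y (Y∈𝓘 , Y⊆B) B∩I⊆Y →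
             (λ {_} → B∩I⊆Y) , spanning⇒maximal proj₁ rB≡0 Y∈𝓘 B∩I⊆Y Y⊆B )
       -- The chain is |I ∖ J| = r(I|J) = r(A|I) + r(I|J) = r(A|J) = r(A|B) with J = `B ∩ I`.
       , trans (sym (r-independent I∈𝓘 B∩I⊆I))
           (trans (sym (+∞-identityˡ _))
           (trans (cong (_+∞ r I (B ∩ I) B∩I⊆I) (sym rAI≡0))
           (trans (sym (R3 A I (B ∩ I) B∩I⊆I I⊆A))
           (r-basis B⊆A proj₁ rB≡0))))
    relativeRank A B B⊆A .proj₂ _
      (I , J , J⊆I , I⊆A , I∈𝓘 , ((J∈𝓘 , J⊆B) , max) , refl) =
      -- For any competing pair, `J` spans `B` by maximality, so |I ∖ J| = r(I|J) is at most r(A|J)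
      -- = r(A|B).
      subst₂ _≤∞_ (r-independent I∈𝓘 J⊆I)
        (r-basis B⊆A J⊆B (maximal⇒spanning J⊆B J∈𝓘
          λ Y Y∈𝓘 J⊆Y Y⊆B → proj₂ (max Y (Y∈𝓘 , λ {_} → Y⊆B) J⊆Y)))
        (r-inner≤ J⊆I I⊆A)

theorem3p1 : (em : Classical) {ℓ : Level} (E : Set ℓ) (r : RankFunction E) →
    RankAxioms em r →
    IsInfiniteMatroid (Independent r) ×
    (∀ A B (B⊆A : B ⊆ A) → RelativeRank em (Independent r) A B (r A B B⊆A))
theorem3p1 em E r axioms = isInfiniteMatroid em r axioms , relativeRank em r axioms
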